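{- For the AdCell problem with budget constraints only, there is an integrality gap of $1-\frac1e$ between the integral allocation and the expectation linear program: for every $\delta>0$ there is an instance (with bids $0\le u_{ij}\le b_i$ for all $i,j$) for which the expected revenue of the optimal offline (integral) allocation is at most $\left(1-\frac1e+\delta\right)\overline{OPT}_B$, where $\overline{OPT}_B>0$ is the optimal value of $\overline{LP}_B$.
   Context: Problem. There are advertisers $i\in[m]$ with budgets $b_i>0$, queries $j\in[n]$, and bids $u_{ij}\ge 0$ of advertiser $i$ for query $j$. Query $j$ arrives with probability $p_j$; $I_j\in\{0,1\}$ is its arrival indicator. Each query $j$ belongs to one customer and has one arrival time. Arrivals of queries with different arrival times or from different customers are independent; queries of the same customer with the same arrival time are mutually exclusive (at most one of them arrives). An (integral) allocation is $X_{ij}\in\{0,1\}$ with $\sum_i X_{ij}\le I_j$ for all $j$. Its revenue is $\sum_i\min\left(\sum_j X_{ij}u_{ij},\,b_i\right)$. The optimal offline allocation is an allocation maximizing the revenue with full knowledge of the realized $I_1,\dots,I_n$. Linear program $\overline{LP}_B$: maximize $\sum_i\sum_j x_{ij}u_{ij}$ subject to $\sum_i x_{ij}\le p_j$ for all $j\in[n]$, $\sum_j x_{ij}u_{ij}\le b_i$ for all $i\in[m]$, and $x_{ij}\in[0,1]$. -}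

module Defs where

open import Algebra.Bundles.Raw using (RawMonoid)
import Algebra.Definitions.RawMonoid as RawMonoidOps
open import Data.Bool using (if_then_else_)
open import Data.Fin using (Fin)
import Data.Fin.Properties as Fin
open import Data.Fin.Subset using (Subset; inside; outside; _∈_)
open import Data.Fin.Subset.Properties using (_∈?_)
import Data.Bool.Properties as Bool
import Data.Integer as ℤ
import Data.Integer.Properties as ℤ
open import Data.Nat using (ℕ; zero; suc; _!; s≤s; z≤n)
import Data.Nat as ℕ
import Data.Nat.Properties as ℕ
import Data.Nat.Solver as ℕ-Solver
open import Data.Product using (∃-syntax; _×_; _,_; proj₁; proj₂)
open import Data.Rational using (ℚ; 0ℚ; 1ℚ; ½)
import Data.Rational as ℚ
import Data.Rational.Properties as ℚ
open import Data.Rational.Solver using (module +-*-Solver)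
import Data.Rational.Unnormalised as ℚᵘ
import Data.Rational.Unnormalised.Properties as ℚᵘ
open import Data.Sum using (inj₁; inj₂)
open import Data.Vec using ([]; _∷_; lookup)
open import Function using (_∘_)
open import Level using (0ℓ)
open import Relation.Binary.PropositionalEquality
  using (_≡_; _≢_; refl; sym; trans; cong; cong₂; subst; subst₂)
open import Relation.Nullary using (does)
open import Relation.Nullary.Decidable using (_×-dec_; _→-dec_)
open import Relation.Unary using (Pred; Decidable)

------------------------------------------------------------------------
-- Auxiliary facts about ℚ

private module Rat where
  open import Data.Rational
  open import Data.Rational.Properties
  open ≤-Reasoning

  p≤∣p∣ : ∀ p → p ≤ ∣ p ∣
  p≤∣p∣ p with ≤-total 0ℚ p
  ... | inj₁ 0≤p = ≤-reflexive (sym (0≤p⇒∣p∣≡p 0≤p))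
  ... | inj₂ p≤0 = ≤-trans p≤0 (0≤∣p∣ p)

  move : ∀ {p q t} → p ≤ q + t → p - q ≤ t
  move {p} {q} {t} h = begin
    p - q         ≤⟨ +-monoˡ-≤ (- q) h ⟩
    q + t - q     ≡⟨ solve 2 (λ q t → q :+ t :+ :- q := t) refl q t ⟩
    t             ∎
    where open +-*-Solver

  dist-intro : ∀ {p q t} → p ≤ q + t → q ≤ p + t → ∣ p - q ∣ ≤ t
  dist-intro {p} {q} {t} h k with ∣p∣≡p∨∣p∣≡-p (p - q)
  ... | inj₁ eq = subst (_≤ t) (sym eq) (move h)
  ... | inj₂ eq = subst (_≤ t) (trans
        (solve 2 (λ p q → q :+ :- p := :- (p :+ :- q)) refl p q) (sym eq)) (move k)
    where open +-*-Solver

  dist-elim : ∀ {p q t} → ∣ p - q ∣ ≤ t → p ≤ q + t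
  dist-elim {p} {q} {t} h = begin
    p             ≡⟨ solve 2 (λ p q → p := q :+ (p :+ :- q)) refl p q ⟩
    q + (p - q)   ≤⟨ +-monoʳ-≤ q (≤-trans (p≤∣p∣ (p - q)) h) ⟩
    q + t         ∎
    where open +-*-Solver

  dist-sym : ∀ p q → ∣ p - q ∣ ≡ ∣ q - p ∣
  dist-sym p q = trans (sym (∣-p∣≡∣p∣ (p - q)))
    (cong ∣_∣ (solve 2 (λ p q → :- (p :+ :- q) := q :+ :- p) refl p q))
    where open +-*-Solver

  *-pos : ∀ {p q} → 0ℚ < p → 0ℚ < q → 0ℚ < p * q
  *-pos {p} {q} 0<p 0<q =
    positive⁻¹ (p * q) {{pos*pos⇒pos p {{positive 0<p}} q {{positive 0<q}}}}

  halves : ∀ ε → ε * ½ + ε * ½ ≡ ε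
  halves ε = trans (sym (*-distribˡ-+ ε ½ ½)) (*-identityʳ ε)

  0<½ : 0ℚ < ½
  0<½ = positive⁻¹ ½

  0<1 : 0ℚ < 1ℚ
  0<1 = positive⁻¹ 1ℚ

  *-mono : ∀ {p q r s} → 0ℚ ≤ r → 0ℚ ≤ q → p ≤ q → r ≤ s → p * r ≤ q * s
  *-mono {p} {q} {r} {s} 0≤r 0≤q p≤q r≤s = ≤-trans
    (*-monoʳ-≤-nonNeg r {{nonNegative 0≤r}} p≤q)
    (*-monoˡ-≤-nonNeg q {{nonNegative 0≤q}} r≤s)

  dist-+ : ∀ {a b c d s t} → ∣ a - c ∣ ≤ s → ∣ b - d ∣ ≤ t →
           ∣ (a + b) - (c + d) ∣ ≤ s + t
  dist-+ {a} {b} {c} {d} {s} {t} h k = begin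
    ∣ (a + b) - (c + d) ∣
      ≡⟨ cong ∣_∣ (solve 4 (λ a b c d → (a :+ b) :+ :- (c :+ d) :=
           (a :+ :- c) :+ (b :+ :- d)) refl a b c d) ⟩
    ∣ (a - c) + (b - d) ∣     ≤⟨ ∣p+q∣≤∣p∣+∣q∣ (a - c) (b - d) ⟩
    ∣ a - c ∣ + ∣ b - d ∣     ≤⟨ +-mono-≤ h k ⟩
    s + t                     ∎
    where open +-*-Solver

  dist-neg : ∀ {a b t} → ∣ a - b ∣ ≤ t → ∣ (- a) - (- b) ∣ ≤ t
  dist-neg {a} {b} {t} h = subst (_≤ t) (trans (dist-sym a b)
    (cong ∣_∣ (solve 2 (λ a b → b :+ :- a := :- a :+ :- (:- b)) refl a b))) h
    where open +-*-Solver

  dist-* : ∀ {a b c d t K L} → 0ℚ ≤ t → ∣ a - c ∣ ≤ t → ∣ b - d ∣ ≤ t →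
           ∣ a ∣ ≤ K → ∣ d ∣ ≤ L → ∣ a * b - c * d ∣ ≤ (K + L) * t
  dist-* {a} {b} {c} {d} {t} {K} {L} 0≤t h k a≤K d≤L = begin
    ∣ a * b - c * d ∣
      ≡⟨ cong ∣_∣ (solve 4 (λ a b c d → a :* b :+ :- (c :* d) :=
           a :* (b :+ :- d) :+ d :* (a :+ :- c)) refl a b c d) ⟩
    ∣ a * (b - d) + d * (a - c) ∣
      ≤⟨ ∣p+q∣≤∣p∣+∣q∣ (a * (b - d)) (d * (a - c)) ⟩
    ∣ a * (b - d) ∣ + ∣ d * (a - c) ∣
      ≡⟨ cong₂ _+_ (∣p*q∣≡∣p∣*∣q∣ a (b - d)) (∣p*q∣≡∣p∣*∣q∣ d (a - c)) ⟩
    ∣ a ∣ * ∣ b - d ∣ + ∣ d ∣ * ∣ a - c ∣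
      ≤⟨ +-mono-≤ (*-mono (0≤∣p∣ (b - d)) (≤-trans (0≤∣p∣ a) a≤K) a≤K k)
                  (*-mono (0≤∣p∣ (a - c)) (≤-trans (0≤∣p∣ d) d≤L) d≤L h) ⟩
    K * t + L * t
      ≡⟨ sym (*-distribʳ-+ t K L) ⟩
    (K + L) * t ∎
    where open +-*-Solver

  abs-near : ∀ {a c} → ∣ a - c ∣ ≤ 1ℚ → ∣ a ∣ ≤ ∣ c ∣ + 1ℚ
  abs-near {a} {c} h = begin
    ∣ a ∣             ≡⟨ cong ∣_∣ (solve 2 (λ a c → a := c :+ (a :+ :- c)) refl a c) ⟩
    ∣ c + (a - c) ∣   ≤⟨ ∣p+q∣≤∣p∣+∣q∣ c (a - c) ⟩
    ∣ c ∣ + ∣ a - c ∣ ≤⟨ +-monoʳ-≤ ∣ c ∣ h ⟩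
    ∣ c ∣ + 1ℚ        ∎
    where open +-*-Solver

  0<∣c∣+1 : ∀ c → 0ℚ < ∣ c ∣ + 1ℚ
  0<∣c∣+1 c = <-≤-trans 0<1 (≤-trans (≤-reflexive (sym (+-identityˡ 1ℚ)))
    (+-monoˡ-≤ 1ℚ (0≤∣p∣ c)))

  dist-⊓ : ∀ {a b c d t} → ∣ a - c ∣ ≤ t → ∣ b - d ∣ ≤ t →
           ∣ (a ⊓ b) - (c ⊓ d) ∣ ≤ t
  dist-⊓ {a} {b} {c} {d} {t} h k = dist-intro (half {a} {b} {c} {d} h k)
    (half {c} {d} {a} {b} (subst (_≤ t) (dist-sym a c) h) (subst (_≤ t) (dist-sym b d) k))
    where
    half : ∀ {a b c d} → ∣ a - c ∣ ≤ t → ∣ b - d ∣ ≤ t → a ⊓ b ≤ c ⊓ d + t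
    half {a} {b} {c} {d} h k = ≤-trans (⊓-mono-≤ (dist-elim {a} {c} h) (dist-elim {b} {d} k))
      (≤-reflexive (sym (mono-≤-distrib-⊓ (+-monoˡ-≤ t) c d)))

  dist-⊔ : ∀ {e a c t} → 0ℚ ≤ t → ∣ a - c ∣ ≤ t → ∣ (e ⊔ a) - (e ⊔ c) ∣ ≤ t
  dist-⊔ {e} {a} {c} {t} 0≤t h =
    dist-intro (half {a} {c} h) (half {c} {a} (subst (_≤ t) (dist-sym a c) h))
    where
    half : ∀ {a c} → ∣ a - c ∣ ≤ t → e ⊔ a ≤ e ⊔ c + t
    half {a} {c} h = ≤-trans
      (⊔-mono-≤ (≤-trans (≤-reflexive (sym (+-identityʳ e))) (+-monoʳ-≤ e 0≤t))
                (dist-elim {a} {c} h))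
      (≤-reflexive (sym (mono-≤-distrib-⊔ (+-monoˡ-≤ t) e c)))

  ⊔-nonZero : ∀ {ε} → 0ℚ < ε → ∀ q → NonZero (ε ⊔ q)
  ⊔-nonZero {ε} 0<ε q = >-nonZero (<-≤-trans 0<ε (p≤p⊔q ε q))

  dist-1/ : ∀ {ε a c t} {{_ : NonZero a}} {{_ : NonZero c}} →
            0ℚ < ε → 0ℚ ≤ t → ε ≤ a → ε ≤ c →
            ∣ a - c ∣ ≤ t * (ε * ε) → ∣ 1/ a - 1/ c ∣ ≤ t
  dist-1/ {ε} {a} {c} {t} 0<ε 0≤t ε≤a ε≤c h = dist-intro
    (half a c ε≤a ε≤c (subst (_≤ t * (ε * ε)) (dist-sym a c) h))
    (half c a ε≤c ε≤a h)
    where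
    open +-*-Solver
    half : ∀ a c {{_ : NonZero a}} {{_ : NonZero c}} → ε ≤ a → ε ≤ c →
           ∣ c - a ∣ ≤ t * (ε * ε) → 1/ a ≤ 1/ c + t
    half a c ε≤a ε≤c h =
      *-cancelʳ-≤-pos (a * c) {{positive (*-pos 0<a 0<c)}} (begin
        1/ a * (a * c)                 ≡⟨ sym (*-assoc (1/ a) a c) ⟩
        1/ a * a * c                   ≡⟨ cong (_* c) (*-inverseˡ a) ⟩
        1ℚ * c                         ≡⟨ *-identityˡ c ⟩
        c                              ≤⟨ dist-elim h ⟩
        a + t * (ε * ε)                ≤⟨ +-monoʳ-≤ a (*-monoˡ-≤-nonNeg t {{nonNegative 0≤t}}
                                            (*-mono (<⇒≤ 0<ε) (<⇒≤ 0<a) ε≤a ε≤c)) ⟩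
        a + t * (a * c)                ≡⟨ cong (_+ t * (a * c)) (sym (*-identityˡ a)) ⟩
        1ℚ * a + t * (a * c)           ≡⟨ cong (λ z → z * a + t * (a * c)) (sym (*-inverseˡ c)) ⟩
        1/ c * c * a + t * (a * c)
          ≡⟨ solve 4 (λ i a c t → i :* c :* a :+ t :* (a :* c) :=
                                  (i :+ t) :* (a :* c)) refl (1/ c) a c t ⟩
        (1/ c + t) * (a * c)           ∎)
      where
      0<a = <-≤-trans 0<ε ε≤a
      0<c = <-≤-trans 0<ε ε≤c

------------------------------------------------------------------------
-- Real numbers: Cauchy sequences of rationals, with all operations taken
-- termwise and equality and order defined in the limit.  Addition,
-- multiplication and minimum are opaque only because normalising rational
-- arithmetic on open terms is prohibitively expensive; seq-+, seq-* and
-- seq-⊓ (or an unfolding clause) recover their definitions.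

IsCauchy : (ℕ → ℚ) → Set
IsCauchy x = ∀ ε → 0ℚ ℚ.< ε →
  ∃[ N ] ∀ k l → N ℕ.≤ k → N ℕ.≤ l → ℚ.∣ x k ℚ.- x l ∣ ℚ.≤ ε

record ℝ : Set where
  constructor mkℝ
  field
    seq    : ℕ → ℚ
    cauchy : IsCauchy seq

open ℝ public

infix 4 _≈_ _≤_ _<_

_≈_ : ℝ → ℝ → Set
x ≈ y = ∀ ε → 0ℚ ℚ.< ε →
  ∃[ N ] ∀ k → N ℕ.≤ k → ℚ.∣ seq x k ℚ.- seq y k ∣ ℚ.≤ ε

_≤_ : ℝ → ℝ → Set
x ≤ y = ∀ ε → 0ℚ ℚ.< ε →
  ∃[ N ] ∀ k → N ℕ.≤ k → seq x k ℚ.≤ seq y k ℚ.+ ε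

_<_ : ℝ → ℝ → Set
x < y = ∃[ ε ] 0ℚ ℚ.< ε ×
  ∃[ N ] (∀ k → N ℕ.≤ k → seq x k ℚ.+ ε ℚ.≤ seq y k)

fromℚ : ℚ → ℝ
fromℚ q = mkℝ (λ _ → q) prf
  where
  abstract
    prf : IsCauchy (λ _ → q)
    prf ε 0<ε = 0 , λ _ _ _ _ →
      ℚ.≤-trans (ℚ.≤-reflexive (cong ℚ.∣_∣ (ℚ.+-inverseʳ q))) (ℚ.<⇒≤ 0<ε)

fromℕ : ℕ → ℝ
fromℕ n = fromℚ (ℤ.+ n ℚ./ 1)

0ℝ 1ℝ : ℝ
0ℝ = fromℚ 0ℚ
1ℝ = fromℚ 1ℚ

private
  ≤ˡ : ∀ {k} m n → m ℕ.⊔ n ℕ.≤ k → m ℕ.≤ k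
  ≤ˡ m n = ℕ.≤-trans (ℕ.m≤m⊔n m n)

  ≤ʳ : ∀ {k} m n → m ℕ.⊔ n ℕ.≤ k → n ℕ.≤ k
  ≤ʳ m n = ℕ.≤-trans (ℕ.m≤n⊔m m n)

infix  8 -_
infixl 7 _*_ _⊓_
infixl 6 _+_ _-_

opaque
  _+_ : ℝ → ℝ → ℝ
  x + y = mkℝ (λ k → seq x k ℚ.+ seq y k) prf
    where
    prf : IsCauchy (λ k → seq x k ℚ.+ seq y k)
    prf ε 0<ε with cauchy x (ε ℚ.* ½) (Rat.*-pos 0<ε Rat.0<½)
                 | cauchy y (ε ℚ.* ½) (Rat.*-pos 0<ε Rat.0<½)
    ... | M , f | N , g = M ℕ.⊔ N , λ k l h h′ →
      subst (_ ℚ.≤_) (Rat.halves ε)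
        (Rat.dist-+ {seq x k} {seq y k} {seq x l} {seq y l}
          (f k l (≤ˡ M N h) (≤ˡ M N h′)) (g k l (≤ʳ M N h) (≤ʳ M N h′)))

  seq-+ : ∀ x y k → seq (x + y) k ≡ seq x k ℚ.+ seq y k
  seq-+ x y k = refl

-_ : ℝ → ℝ
- x = mkℝ (λ k → ℚ.- seq x k) prf
  where
  abstract
    prf : IsCauchy (λ k → ℚ.- seq x k)
    prf ε 0<ε with cauchy x ε 0<ε
    ... | N , f = N , λ k l h h′ → Rat.dist-neg {seq x k} {seq x l} (f k l h h′)

_-_ : ℝ → ℝ → ℝ
x - y = x + (- y)

private
  *-cauchy : ∀ x y → IsCauchy (λ k → seq x k ℚ.* seq y k)
  *-cauchy x y ε 0<ε = N , λ k l h h′ →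
      subst (ℚ.∣ seq x k ℚ.* seq y k ℚ.- seq x l ℚ.* seq y l ∣ ℚ.≤_) Bt≡ε
        (Rat.dist-* {seq x k} {seq y k} {seq x l} {seq y l}
          (ℚ.<⇒≤ 0<t)
          (proj₂ cx k l (N₃≤ h) (N₃≤ h′)) (proj₂ cy k l (N₄≤ h) (N₄≤ h′))
          (Rat.abs-near {seq x k} (proj₂ bx k N₁ (N₁≤ h) ℕ.≤-refl))
          (Rat.abs-near {seq y l} (proj₂ by l N₂ (N₂≤ h′) ℕ.≤-refl)))
    where
    bx = cauchy x 1ℚ Rat.0<1
    by = cauchy y 1ℚ Rat.0<1
    N₁ = proj₁ bx
    N₂ = proj₁ by
    B = (ℚ.∣ seq x N₁ ∣ ℚ.+ 1ℚ) ℚ.+ (ℚ.∣ seq y N₂ ∣ ℚ.+ 1ℚ)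
    instance
      B>0 : ℚ.Positive B
      B>0 = ℚ.pos+pos⇒pos
        (ℚ.∣ seq x N₁ ∣ ℚ.+ 1ℚ) {{ℚ.positive (Rat.0<∣c∣+1 (seq x N₁))}}
        (ℚ.∣ seq y N₂ ∣ ℚ.+ 1ℚ) {{ℚ.positive (Rat.0<∣c∣+1 (seq y N₂))}}
      B≢0 : ℚ.NonZero B
      B≢0 = ℚ.pos⇒nonZero B
    t = ε ℚ.* ℚ.1/ B
    0<t : 0ℚ ℚ.< t
    0<t = Rat.*-pos 0<ε (ℚ.positive⁻¹ (ℚ.1/ B) {{ℚ.1/pos⇒pos B}})
    Bt≡ε : B ℚ.* t ≡ ε
    Bt≡ε = trans (ℚ.*-comm B t) (trans (ℚ.*-assoc ε (ℚ.1/ B) B)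
      (trans (cong (ε ℚ.*_) (ℚ.*-inverseˡ B)) (ℚ.*-identityʳ ε)))
    cx = cauchy x t 0<t
    cy = cauchy y t 0<t
    N₃ = proj₁ cx
    N₄ = proj₁ cy
    N = (N₁ ℕ.⊔ N₂) ℕ.⊔ (N₃ ℕ.⊔ N₄)
    N₁≤ : ∀ {k} → N ℕ.≤ k → N₁ ℕ.≤ k
    N₁≤ h = ≤ˡ N₁ N₂ (≤ˡ (N₁ ℕ.⊔ N₂) (N₃ ℕ.⊔ N₄) h)
    N₂≤ : ∀ {k} → N ℕ.≤ k → N₂ ℕ.≤ k
    N₂≤ h = ≤ʳ N₁ N₂ (≤ˡ (N₁ ℕ.⊔ N₂) (N₃ ℕ.⊔ N₄) h)
    N₃≤ : ∀ {k} → N ℕ.≤ k → N₃ ℕ.≤ k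
    N₃≤ h = ≤ˡ N₃ N₄ (≤ʳ (N₁ ℕ.⊔ N₂) (N₃ ℕ.⊔ N₄) h)
    N₄≤ : ∀ {k} → N ℕ.≤ k → N₄ ℕ.≤ k
    N₄≤ h = ≤ʳ N₃ N₄ (≤ʳ (N₁ ℕ.⊔ N₂) (N₃ ℕ.⊔ N₄) h)

opaque
  _*_ : ℝ → ℝ → ℝ
  x * y = mkℝ (λ k → seq x k ℚ.* seq y k) (*-cauchy x y)

  seq-* : ∀ x y k → seq (x * y) k ≡ seq x k ℚ.* seq y k
  seq-* x y k = refl

opaque
  _⊓_ : ℝ → ℝ → ℝ
  x ⊓ y = mkℝ (λ k → seq x k ℚ.⊓ seq y k) prf
    where
    prf : IsCauchy (λ k → seq x k ℚ.⊓ seq y k)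
    prf ε 0<ε with cauchy x ε 0<ε | cauchy y ε 0<ε
    ... | M , f | N , g = M ℕ.⊔ N , λ k l h h′ →
      Rat.dist-⊓ {seq x k} {seq y k} {seq x l} {seq y l}
        (f k l (≤ˡ M N h) (≤ˡ M N h′)) (g k l (≤ʳ M N h) (≤ʳ M N h′))

  seq-⊓ : ∀ x y k → seq (x ⊓ y) k ≡ seq x k ℚ.⊓ seq y k
  seq-⊓ x y k = refl

-- The proof of 0 < x supplies a rational ε > 0 which eventually bounds the
-- terms of x from below.  Replacing x k by ε ⊔ x k therefore changes only
-- finitely many terms, and makes each of them invertible.
inv : (x : ℝ) → 0ℝ < x → ℝ
inv x (ε , 0<ε , _) = mkℝ y prf
  where
  y : ℕ → ℚ
  y k = (ℚ.1/ (ε ℚ.⊔ seq x k)) {{Rat.⊔-nonZero 0<ε (seq x k)}}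
  abstract
    prf : IsCauchy y
    prf t 0<t with cauchy x (t ℚ.* (ε ℚ.* ε)) (Rat.*-pos 0<t (Rat.*-pos 0<ε 0<ε))
    ... | N , f = N , λ k l h h′ →
      Rat.dist-1/ {ε} {ε ℚ.⊔ seq x k} {ε ℚ.⊔ seq x l}
        {{Rat.⊔-nonZero 0<ε (seq x k)}} {{Rat.⊔-nonZero 0<ε (seq x l)}}
        0<ε (ℚ.<⇒≤ 0<t) (ℚ.p≤p⊔q ε (seq x k)) (ℚ.p≤p⊔q ε (seq x l))
        (Rat.dist-⊔ {ε} {seq x k} {seq x l}
          (ℚ.<⇒≤ (Rat.*-pos 0<t (Rat.*-pos 0<ε 0<ε))) (f k l h h′))

------------------------------------------------------------------------
-- Euler's number e = Σₖ 1/k!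

1/_! : ℕ → ℚ
1/ k ! = (ℤ.+ 1 ℚ./ (k !)) {{ℕ._!≢0 k}}

eSeq : ℕ → ℚ
eSeq zero    = 1/ 0 !
eSeq (suc k) = eSeq k ℚ.+ 1/ suc k !

private
  /-mono : ∀ a b c d {{_ : ℕ.NonZero b}} {{_ : ℕ.NonZero d}} →
           a ℕ.* d ℕ.≤ c ℕ.* b → ℤ.+ a ℚ./ b ℚ.≤ ℤ.+ c ℚ./ d
  /-mono a (suc b) c (suc d) h = ℚ.toℚᵘ-cancel-≤
    (ℚᵘ.≤-respˡ-≃ (ℚᵘ.≃-sym (ℚ.toℚᵘ-fromℚᵘ (ℚᵘ.mkℚᵘ (ℤ.+ a) b)))
    (ℚᵘ.≤-respʳ-≃ (ℚᵘ.≃-sym (ℚ.toℚᵘ-fromℚᵘ (ℚᵘ.mkℚᵘ (ℤ.+ c) d)))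
      (ℚᵘ.*≤* (subst₂ ℤ._≤_ (ℤ.pos-* a (suc d)) (ℤ.pos-* c (suc b)) (ℤ.+≤+ h)))))

  1/-double : ∀ D F {{_ : ℕ.NonZero D}} {{_ : ℕ.NonZero F}} → 2 ℕ.* F ℕ.≤ D →
              ℤ.+ 1 ℚ./ D ℚ.+ ℤ.+ 1 ℚ./ D ℚ.≤ ℤ.+ 1 ℚ./ F
  1/-double (suc d) (suc f) h = ℚ.toℚᵘ-cancel-≤
    (ℚᵘ.≤-respˡ-≃ (ℚᵘ.≃-sym (ℚᵘ.≃-trans
        (ℚ.toℚᵘ-homo-+ (ℤ.+ 1 ℚ./ suc d) (ℤ.+ 1 ℚ./ suc d))
        (ℚᵘ.+-cong (ℚ.toℚᵘ-fromℚᵘ (ℚᵘ.mkℚᵘ (ℤ.+ 1) d))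
                   (ℚ.toℚᵘ-fromℚᵘ (ℚᵘ.mkℚᵘ (ℤ.+ 1) d)))))
    (ℚᵘ.≤-respʳ-≃ (ℚᵘ.≃-sym (ℚ.toℚᵘ-fromℚᵘ (ℚᵘ.mkℚᵘ (ℤ.+ 1) f)))
      (ℚᵘ.*≤* (ℤ.+≤+ goal))))
    where
    D = suc d
    F = suc f
    open ℕ.≤-Reasoning
    goal : (1 ℕ.* D ℕ.+ 1 ℕ.* D) ℕ.* F ℕ.≤ 1 ℕ.* (D ℕ.* D)
    goal = begin
      (1 ℕ.* D ℕ.+ 1 ℕ.* D) ℕ.* F
        ≡⟨ solve 2 (λ D F → (con 1 :* D :+ con 1 :* D) :* F :=
                            D :* (con 2 :* F)) refl D F ⟩
      D ℕ.* (2 ℕ.* F)   ≤⟨ ℕ.*-monoʳ-≤ D h ⟩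
      D ℕ.* D           ≡⟨ sym (ℕ.*-identityˡ (D ℕ.* D)) ⟩
      1 ℕ.* (D ℕ.* D)   ∎
      where open ℕ-Solver.+-*-Solver

  0≤1/! : ∀ k → 0ℚ ℚ.≤ 1/ k !
  0≤1/! k = /-mono 0 1 1 (k !) {{_}} {{ℕ._!≢0 k}} z≤n

  eSeq-step : ∀ k → eSeq k ℚ.≤ eSeq (suc k)
  eSeq-step k = ℚ.≤-trans (ℚ.≤-reflexive (sym (ℚ.+-identityʳ (eSeq k))))
    (ℚ.+-monoʳ-≤ (eSeq k) (0≤1/! (suc k)))

  eSeq-bound-step : ∀ k → 1 ℕ.≤ k →
    eSeq (suc k) ℚ.+ 1/ suc k ! ℚ.≤ eSeq k ℚ.+ 1/ k !
  eSeq-bound-step k 1≤k = ℚ.≤-trans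
    (ℚ.≤-reflexive (ℚ.+-assoc (eSeq k) (1/ suc k !) (1/ suc k !)))
    (ℚ.+-monoʳ-≤ (eSeq k) (1/-double (suc k !) (k !)
      {{ℕ._!≢0 (suc k)}} {{ℕ._!≢0 k}} (ℕ.*-monoˡ-≤ (k !) (s≤s 1≤k))))

  eSeq-above : ∀ {N k} → N ℕ.≤′ k → eSeq N ℚ.≤ eSeq k
  eSeq-above ℕ.≤′-refl     = ℚ.≤-refl
  eSeq-above (ℕ.≤′-step {k} h) = ℚ.≤-trans (eSeq-above h) (eSeq-step k)

  eSeq-below : ∀ {N k} → 1 ℕ.≤ N → N ℕ.≤′ k →
               eSeq k ℚ.+ 1/ k ! ℚ.≤ eSeq N ℚ.+ 1/ N !
  eSeq-below 1≤N ℕ.≤′-refl     = ℚ.≤-refl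
  eSeq-below 1≤N (ℕ.≤′-step {k} h) = ℚ.≤-trans
    (eSeq-bound-step k (ℕ.≤-trans 1≤N (ℕ.≤′⇒≤ h))) (eSeq-below 1≤N h)

  n≤n! : ∀ n → n ℕ.≤ n !
  n≤n! zero    = z≤n
  n≤n! (suc n) = subst (ℕ._≤ suc n !) (ℕ.*-identityʳ (suc n))
    (ℕ.*-monoʳ-≤ (suc n) (ℕ.1≤n! n))

  1/!-small : ∀ ε → 0ℚ ℚ.< ε → 1/ ℚ.↧ₙ ε ! ℚ.≤ ε
  1/!-small ε 0<ε = positiveCase ε (ℚ.positive 0<ε)
    where
    positiveCase : ∀ ε → ℚ.Positive ε → 1/ ℚ.↧ₙ ε ! ℚ.≤ ε
    positiveCase ε@(ℚ.mkℚ (ℤ.+ suc p) d _) _ = subst (1/ suc d ! ℚ.≤_) (ℚ.↥p/↧p≡p ε)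
      (/-mono 1 (suc d !) (suc p) (suc d) {{ℕ._!≢0 (suc d)}}
        (ℕ.*-mono-≤ (s≤s (z≤n {p})) (n≤n! (suc d))))

  eSeq-near : ∀ ε → 0ℚ ℚ.< ε → ∀ k l → ℚ.↧ₙ ε ℕ.≤ k → ℚ.↧ₙ ε ℕ.≤ l →
              eSeq k ℚ.≤ eSeq l ℚ.+ ε
  eSeq-near ε 0<ε k l h h′ = begin
    eSeq k                          ≡⟨ sym (ℚ.+-identityʳ (eSeq k)) ⟩
    eSeq k ℚ.+ 0ℚ                   ≤⟨ ℚ.+-monoʳ-≤ (eSeq k) (0≤1/! k) ⟩
    eSeq k ℚ.+ 1/ k !               ≤⟨ eSeq-below (s≤s z≤n) (ℕ.≤⇒≤′ h) ⟩
    eSeq N ℚ.+ 1/ N !               ≤⟨ ℚ.+-mono-≤ (eSeq-above (ℕ.≤⇒≤′ h′)) (1/!-small ε 0<ε) ⟩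
    eSeq l ℚ.+ ε                    ∎
    where
    N = ℚ.↧ₙ ε
    open ℚ.≤-Reasoning

e : ℝ
e = mkℝ eSeq prf
  where
  abstract
    prf : IsCauchy eSeq
    prf ε 0<ε = ℚ.↧ₙ ε , λ k l h h′ →
      Rat.dist-intro (eSeq-near ε 0<ε k l h h′) (eSeq-near ε 0<ε l k h′ h)

0<e : 0ℝ < e
0<e = 1ℚ , Rat.0<1 , 0 , λ k _ → eSeq-above {0} {k} (ℕ.≤⇒≤′ z≤n)

e⁻¹ : ℝ
e⁻¹ = inv e 0<e

------------------------------------------------------------------------
-- Finite sums and products

+-rawMonoid *-rawMonoid : RawMonoid 0ℓ 0ℓ
+-rawMonoid = record { _≈_ = _≈_ ; _∙_ = _+_ ; ε = 0ℝ }
*-rawMonoid = record { _≈_ = _≈_ ; _∙_ = _*_ ; ε = 1ℝ }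

∑ ∏ : ∀ {n} → (Fin n → ℝ) → ℝ
∑ = RawMonoidOps.sum +-rawMonoid
∏ = RawMonoidOps.sum *-rawMonoid

∑ℕ : ∀ {n} → (Fin n → ℕ) → ℕ
∑ℕ = RawMonoidOps.sum ℕ.+-0-rawMonoid

∑⊆ : ∀ {n} → (Subset n → ℝ) → ℝ
∑⊆ {zero}  f = f []
∑⊆ {suc n} f = ∑⊆ (f ∘ (outside ∷_)) + ∑⊆ (f ∘ (inside ∷_))

------------------------------------------------------------------------
-- The AdCell problem with budget constraints only

-- The realised arrivals (I₁,…,Iₙ) ∈ {0,1}ⁿ are encoded as the subset of
-- queries that arrive, and their joint distribution as the mass function Pr.

record AdCellData : Set where
  field
    m n               : ℕ
    #customers #times : ℕ
    b        : Fin m → ℝ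
    u        : Fin m → Fin n → ℝ
    p        : Fin n → ℝ
    customer : Fin n → Fin #customers
    time     : Fin n → Fin #times
    Pr       : Subset n → ℝ

  ℙ : {E : Pred (Subset n) 0ℓ} → Decidable E → ℝ
  ℙ E? = ∑⊆ λ I → if does (E? I) then Pr I else 0ℝ

  𝔼 : (Subset n → ℝ) → ℝ
  𝔼 f = ∑⊆ λ I → Pr I * f I

  Arrives : Fin n → Pred (Subset n) 0ℓ
  Arrives j I = j ∈ I

  arrives? : ∀ j → Decidable (Arrives j)
  arrives? j I = j ∈? I

  BothArrive : Fin n → Fin n → Pred (Subset n) 0ℓ
  BothArrive j k I = Arrives j I × Arrives k I

  bothArrive? : ∀ j k → Decidable (BothArrive j k)
  bothArrive? j k I = arrives? j I ×-dec arrives? k I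

  Agrees : Subset n → Fin #customers → Fin #times → Pred (Subset n) 0ℓ
  Agrees s c t I = ∀ j → customer j ≡ c → time j ≡ t → lookup I j ≡ lookup s j

  agrees? : ∀ s c t → Decidable (Agrees s c t)
  agrees? s c t I = Fin.all? λ j →
    (customer j Fin.≟ c) →-dec ((time j Fin.≟ t) →-dec
      (lookup I j Bool.≟ lookup s j))

  -- Mutual independence of the random vectors (Iⱼ : customer j ≡ c, time j ≡ t),
  -- one for each pair (c , t).  For a pair without queries the vector is
  -- empty and its factor is the total mass 1.
  Independent : Set
  Independent = ∀ s → Pr s ≈
    ∏ {#customers} λ c → ∏ {#times} λ t → ℙ {Agrees s c t} (agrees? s c t)

record AdCell : Set where
  field
    adCellData : AdCellData

  open AdCellData adCellData public

  field
    b-positive    : ∀ i → 0ℝ < b i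
    u-nonNegative : ∀ i j → 0ℝ ≤ u i j

    Pr-nonNegative : ∀ I → 0ℝ ≤ Pr I
    Pr-total       : ∑⊆ Pr ≈ 1ℝ

    arrival : ∀ j → ℙ (arrives? j) ≈ p j

    exclusive : ∀ j k → j ≢ k → customer j ≡ customer k → time j ≡ time k →
                ℙ (bothArrive? j k) ≈ 0ℝ

    independent : Independent

  Allocation : Set
  Allocation = Fin m → Fin n → ℕ

  record IsAllocation (I : Subset n) (X : Allocation) : Set where
    field
      integral : ∀ i j → X i j ℕ.≤ 1
      arrived  : ∀ j → ∑ℕ (λ i → X i j) ℕ.≤ (if lookup I j then 1 else 0)

  revenue : Allocation → ℝ
  revenue X = ∑ λ i → (∑ λ j → fromℕ (X i j) * u i j) ⊓ b i

  record IsOptimalOffline (I : Subset n) (X : Allocation) : Set where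
    field
      isAllocation : IsAllocation I X
      maximal      : ∀ Y → IsAllocation I Y → revenue Y ≤ revenue X

  record IsFeasible (x : Fin m → Fin n → ℝ) : Set where
    field
      supply   : ∀ j → ∑ (λ i → x i j) ≤ p j
      budget   : ∀ i → ∑ (λ j → x i j * u i j) ≤ b i
      bounds   : ∀ i j → 0ℝ ≤ x i j × x i j ≤ 1ℝ

  value : (Fin m → Fin n → ℝ) → ℝ
  value x = ∑ λ i → ∑ λ j → x i j * u i j

  IsOptimalValue : ℝ → Set
  IsOptimalValue v =
    (∃[ x ] IsFeasible x × value x ≈ v) × (∀ x → IsFeasible x → value x ≤ v)

{-# OPTIONS --safe #-}
module Submission where

-- A single advertiser with budget 1 bids 1 on N = M + 1 independent queries,
-- each arriving with probability 1/N.  The LP spends the whole budget, while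
-- the offline optimum earns 1 exactly when some query arrives, so its expected
-- revenue is 1 - (1 - 1/N)ᴺ.  To compare with 1/e, note that
-- (1 - 1/N)(1 + 1/M) = 1 and (1 + 1/M)ᴹ ≤ Σ_{k≤M} 1/k!; the latter follows from
-- (1 + x) T_k(y) ≤ T_{k+1}(y + x) for the Taylor polynomials T_k of exp.

open import Defs using (1/_!; eSeq)

open import Algebra.Bundles using (CommutativeRing)
import Algebra.Properties.CommutativeSemiring.Exp as Exp
import Algebra.Properties.CommutativeMonoid.Sum as Sum
import Algebra.Properties.Semiring.Mult as Mult
open import Data.Bool using (Bool; true; false; if_then_else_)
import Data.Bool.Properties as Bool
open import Data.Fin using (Fin; zero; suc)
open import Data.Fin.Subset using (Subset; inside; outside)
open import Data.Fin.Subset.Properties using (_∈?_)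
import Data.Integer as ℤ
import Data.Integer.Properties as ℤ
import Data.Integer.Solver as ℤ-Solver
open import Data.Nat using (ℕ; zero; suc)
import Data.Nat as ℕ
import Data.Nat.Properties as ℕ
import Data.Rational as ℚ
open import Data.Rational using (ℚ; 0ℚ; 1ℚ)
import Data.Rational.Properties as ℚ
open import Data.Rational.Solver using (module +-*-Solver)
import Data.Rational.Unnormalised as ℚᵘ
import Data.Rational.Unnormalised.Properties as ℚᵘ
open import Data.Vec using ([]; _∷_; lookup)
open import Function using (_∘_)
open import Relation.Binary.PropositionalEquality
  using (_≡_; refl; sym; trans; cong; cong₂; subst; subst₂)
open import Relation.Nullary using (does)

module Rational where
  open import Data.Rational hiding (1/_)
  open import Data.Rational.Properties
  open CommutativeRing +-*-commutativeRing
    using (semiring; commutativeSemiring; +-commutativeMonoid)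
  open Exp commutativeSemiring public using (_^_; ^-distrib-*)
  open Mult semiring public using (_×_; ×-assoc-*; ×-comm-*)
  open Sum +-commutativeMonoid public using (sum; sum-replicate; sum-cong-≗)
  open Sum *-1-commutativeMonoid public using ()
    renaming (sum to product; sum-cong-≗ to product-cong)
  open ≤-Reasoning

  -- Fractions with natural numerators, and reciprocals of factorials.

  /-cross : ∀ a b c d .{{_ : ℕ.NonZero b}} .{{_ : ℕ.NonZero d}} →
            a ℕ.* d ≡ c ℕ.* b → ℤ.+ a / b ≡ ℤ.+ c / d
  /-cross a (suc b) c (suc d) eq = fromℚᵘ-cong {ℚᵘ.mkℚᵘ (ℤ.+ a) b} {ℚᵘ.mkℚᵘ (ℤ.+ c) d}
    (ℚᵘ.*≡* (trans (sym (ℤ.pos-* a (suc d))) (trans (cong ℤ.+_ eq) (ℤ.pos-* c (suc b)))))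

  /-distrib-+ : ∀ a c d .{{_ : ℕ.NonZero d}} →
                ℤ.+ (a ℕ.+ c) / d ≡ ℤ.+ a / d + ℤ.+ c / d
  /-distrib-+ a c (suc d) = toℚᵘ-injective
    (ℚᵘ.≃-trans (toℚᵘ-fromℚᵘ (ℚᵘ.mkℚᵘ (ℤ.+ (a ℕ.+ c)) d))
    (ℚᵘ.≃-trans (ℚᵘ.*≡* cross)
    (ℚᵘ.≃-sym (ℚᵘ.≃-trans (toℚᵘ-homo-+ (ℤ.+ a / suc d) (ℤ.+ c / suc d))
      (ℚᵘ.+-cong (toℚᵘ-fromℚᵘ (ℚᵘ.mkℚᵘ (ℤ.+ a) d)) (toℚᵘ-fromℚᵘ (ℚᵘ.mkℚᵘ (ℤ.+ c) d)))))))
    where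
    cross : ℤ.+ (a ℕ.+ c) ℤ.* (ℤ.+ suc d ℤ.* ℤ.+ suc d) ≡
            (ℤ.+ a ℤ.* ℤ.+ suc d ℤ.+ ℤ.+ c ℤ.* ℤ.+ suc d) ℤ.* ℤ.+ suc d
    cross = solve 3 (λ a c d → (a :+ c) :* (d :* d) := (a :* d :+ c :* d) :* d) refl
      (ℤ.+ a) (ℤ.+ c) (ℤ.+ suc d)
      where open ℤ-Solver.+-*-Solver

  ×-1/ : ∀ n d .{{_ : ℕ.NonZero d}} → n × (ℤ.+ 1 / d) ≡ ℤ.+ n / d
  ×-1/ zero    d = /-cross 0 1 0 d refl
  ×-1/ (suc n) d = trans (cong (ℤ.+ 1 / d +_) (×-1/ n d)) (sym (/-distrib-+ 1 n d))

  n×1/n≡1 : ∀ n .{{_ : ℕ.NonZero n}} → n × (ℤ.+ 1 / n) ≡ 1ℚ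
  n×1/n≡1 n = trans (×-1/ n n) (/-cross n n 1 1 (ℕ.*-comm n 1))

  -- Lets the factor n + 1 from the linear binomial term turn the coefficient of one Taylor term
  -- into that of the preceding term.
  n×1/n!≡1/[n-1]! : ∀ n → suc n × (1/ suc n !) ≡ 1/ n !
  n×1/n!≡1/[n-1]! n = trans (×-1/ (suc n) (suc n ℕ.!) {{ℕ._!≢0 (suc n)}})
    (/-cross (suc n) (suc n ℕ.!) 1 (n ℕ.!) {{ℕ._!≢0 (suc n)}} {{ℕ._!≢0 n}}
      (sym (ℕ.*-identityˡ (suc n ℕ.!))))

  0≤+n/d : ∀ n d .{{_ : ℕ.NonZero d}} → 0ℚ ≤ ℤ.+ n / d
  0≤+n/d n d = nonNegative⁻¹ (ℤ.+ n / d) {{normalize-nonNeg n d}}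

  0≤1/! : ∀ k → 0ℚ ≤ 1/ k !
  0≤1/! k = 0≤+n/d 1 (k ℕ.!) {{ℕ._!≢0 k}}

  p≤p+q : ∀ p {q} → 0ℚ ≤ q → p ≤ p + q
  p≤p+q p {q} 0≤q = subst (_≤ p + q) (+-identityʳ p) (+-monoʳ-≤ p 0≤q)

  -- A positive rational has numerator at least 1; writing the numerator as 1 plus its predecessor
  -- exhibits the gap as a nonnegative fraction.
  1/↧≤ : ∀ ε → 0ℚ < ε → ℤ.+ 1 / ↧ₙ ε ≤ ε
  1/↧≤ ε 0<ε = begin
    ℤ.+ 1 / ↧ₙ ε
      ≤⟨ p≤p+q (ℤ.+ 1 / ↧ₙ ε) (0≤+n/d (ℕ.pred ℤ.∣ ↥ ε ∣) (↧ₙ ε)) ⟩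
    ℤ.+ 1 / ↧ₙ ε + ℤ.+ ℕ.pred ℤ.∣ ↥ ε ∣ / ↧ₙ ε
      ≡⟨ /-distrib-+ 1 (ℕ.pred ℤ.∣ ↥ ε ∣) (↧ₙ ε) ⟨
    ℤ.+ suc (ℕ.pred ℤ.∣ ↥ ε ∣) / ↧ₙ ε
      ≡⟨ numerator ε (positive 0<ε) ⟩
    ε ∎
    where
    numerator : ∀ ε → Positive ε → ℤ.+ suc (ℕ.pred ℤ.∣ ↥ ε ∣) / ↧ₙ ε ≡ ε
    numerator ε@(mkℚ (ℤ.+ suc _) _ _) _ = ↥p/↧p≡p ε

  -- Order, powers and the binomial inequality.

  *-monoˡ : ∀ {r p q} → 0ℚ ≤ r → p ≤ q → r * p ≤ r * q
  *-monoˡ {r} 0≤r = *-monoˡ-≤-nonNeg r {{nonNegative 0≤r}}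

  *-monoʳ : ∀ {r p q} → 0ℚ ≤ r → p ≤ q → p * r ≤ q * r
  *-monoʳ {r} 0≤r = *-monoʳ-≤-nonNeg r {{nonNegative 0≤r}}

  0≤* : ∀ {p q} → 0ℚ ≤ p → 0ℚ ≤ q → 0ℚ ≤ p * q
  0≤* {p} {q} 0≤p 0≤q = subst (_≤ p * q) (*-zeroʳ p) (*-monoˡ 0≤p 0≤q)

  0≤+ : ∀ {p q} → 0ℚ ≤ p → 0ℚ ≤ q → 0ℚ ≤ p + q
  0≤+ = +-mono-≤

  0≤^ : ∀ {x} n → 0ℚ ≤ x → 0ℚ ≤ x ^ n
  0≤^ zero    0≤x = 0≤+n/d 1 1
  0≤^ (suc n) 0≤x = 0≤* 0≤x (0≤^ n 0≤x)

  0≤× : ∀ {x} n → 0ℚ ≤ x → 0ℚ ≤ n × x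
  0≤× zero    0≤x = ≤-refl
  0≤× (suc n) 0≤x = 0≤+ 0≤x (0≤× n 0≤x)

  1^n≡1 : ∀ n → 1ℚ ^ n ≡ 1ℚ
  1^n≡1 zero    = refl
  1^n≡1 (suc n) = trans (*-identityˡ (1ℚ ^ n)) (1^n≡1 n)

  ^-≤1 : ∀ {x} n → 0ℚ ≤ x → x ≤ 1ℚ → x ^ n ≤ 1ℚ
  ^-≤1 zero    0≤x x≤1 = ≤-refl
  ^-≤1 {x} (suc n) 0≤x x≤1 = ≤-trans (*-monoˡ 0≤x (^-≤1 n 0≤x x≤1))
    (subst (_≤ 1ℚ) (sym (*-identityʳ x)) x≤1)

  -- The first two terms of the binomial expansion of (y + x)ⁿ⁺¹.
  binomial-≤ : ∀ {x y} n → 0ℚ ≤ x → 0ℚ ≤ y →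
               y ^ suc n + x * (suc n × (y ^ n)) ≤ (y + x) ^ suc n
  binomial-≤ {x} {y} zero 0≤x 0≤y = ≤-reflexive
    (solve 2 (λ x y → y :* con 1ℚ :+ x :* (con 1ℚ :+ con 0ℚ) := (y :+ x) :* con 1ℚ) refl x y)
    where open +-*-Solver
  binomial-≤ {x} {y} (suc n) 0≤x 0≤y = begin
    y ^ suc (suc n) + x * (suc (suc n) × (y ^ suc n))
      ≡⟨ cong (λ z → y ^ suc (suc n) + x * (y ^ suc n + z)) (×-comm-* (suc n) y (y ^ n)) ⟨
    y * (y * P) + x * (y * P + y * Q)
      -- Adding `x * x * Q` completes the product of `y + x` with the left side of the induction
      -- hypothesis.
      ≤⟨ p≤p+q (y * (y * P) + x * (y * P + y * Q)) (0≤* (0≤* 0≤x 0≤x) (0≤× (suc n) (0≤^ n 0≤y))) ⟩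
    y * (y * P) + x * (y * P + y * Q) + x * x * Q
      ≡⟨ solve 4 (λ x y P Q → y :* (y :* P) :+ x :* (y :* P :+ y :* Q) :+ x :* x :* Q :=
           (y :+ x) :* (y :* P :+ x :* Q)) refl x y P Q ⟩
    (y + x) * (y ^ suc n + x * Q)
      ≤⟨ *-monoˡ (0≤+ 0≤y 0≤x) (binomial-≤ n 0≤x 0≤y) ⟩
    (y + x) ^ suc (suc n) ∎
    where
    open +-*-Solver
    P = y ^ n
    Q = suc n × (y ^ n)

  -- Taylor polynomials of the exponential function.

  -- This is T_k(y). The constant term is spelled out as `y ^ 0 * 1/ 0 !` so that it has the shape
  -- `term-shift` expects.
  expSum : ℕ → ℚ → ℚ
  expSum zero    y = y ^ 0 * 1/ 0 !
  expSum (suc k) y = expSum k y + y ^ suc k * 1/ suc k !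

  expSum-1 : ∀ k → expSum k 1ℚ ≡ eSeq k
  expSum-1 zero    = refl
  expSum-1 (suc k) = cong₂ _+_ (expSum-1 k)
    (trans (cong (_* 1/ suc k !) (1^n≡1 (suc k))) (*-identityˡ (1/ suc k !)))

  -- `binomial-≤` divided by (k+1)!: the linear term of the binomial expansion becomes `x` times the
  -- Taylor term of degree k.
  term-shift : ∀ {x y} k → 0ℚ ≤ x → 0ℚ ≤ y →
    y ^ suc k * 1/ suc k ! + x * (y ^ k * 1/ k !) ≤ (y + x) ^ suc k * 1/ suc k !
  term-shift {x} {y} k 0≤x 0≤y = begin
    y ^ suc k * c + x * (y ^ k * 1/ k !)
      ≡⟨ cong (λ z → y ^ suc k * c + x * (y ^ k * z)) (n×1/n!≡1/[n-1]! k) ⟨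
    y ^ suc k * c + x * (y ^ k * (suc k × c))
      ≡⟨ cong (λ z → y ^ suc k * c + x * z)
           (trans (×-comm-* (suc k) (y ^ k) c) (sym (×-assoc-* (suc k) (y ^ k) c))) ⟩
    y ^ suc k * c + x * ((suc k × (y ^ k)) * c)
      ≡⟨ solve 4 (λ c x A B → A :* c :+ x :* (B :* c) := (A :+ x :* B) :* c) refl
           c x (y ^ suc k) (suc k × (y ^ k)) ⟩
    (y ^ suc k + x * (suc k × (y ^ k))) * c
      ≤⟨ *-monoʳ (0≤1/! (suc k)) (binomial-≤ k 0≤x 0≤y) ⟩
    (y + x) ^ suc k * c ∎
    where
    open +-*-Solver
    c = 1/ suc k !

  -- `term-shift` summed over the degrees: `x` times each term is paired with the term one degree
  -- higher, and the constant term is common to both sides.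
  expSum-shift : ∀ {x y} k → 0ℚ ≤ x → 0ℚ ≤ y →
    expSum (suc k) y + x * expSum k y ≤ expSum (suc k) (y + x)
  expSum-shift {x} {y} zero 0≤x 0≤y = begin
    expSum 0 y + y ^ 1 * 1/ 1 ! + x * expSum 0 y
      ≡⟨ +-assoc (expSum 0 y) (y ^ 1 * 1/ 1 !) (x * expSum 0 y) ⟩
    expSum 0 y + (y ^ 1 * 1/ 1 ! + x * expSum 0 y)
      ≤⟨ +-monoʳ-≤ (expSum 0 y) (term-shift 0 0≤x 0≤y) ⟩
    expSum 0 y + (y + x) ^ 1 * 1/ 1 !              ∎
  expSum-shift {x} {y} (suc k) 0≤x 0≤y = begin
    A + B + x * (C + D)       ≡⟨ solve 5 (λ x A B C D → A :+ B :+ x :* (C :+ D) :=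
                                   (A :+ x :* C) :+ (B :+ x :* D)) refl x A B C D ⟩
    (A + x * C) + (B + x * D) ≤⟨ +-mono-≤ (expSum-shift k 0≤x 0≤y) (term-shift (suc k) 0≤x 0≤y) ⟩
    expSum (suc (suc k)) (y + x) ∎
    where
    open +-*-Solver
    A = expSum (suc k) y
    B = y ^ suc (suc k) * 1/ suc (suc k) !
    C = expSum k y
    D = y ^ suc k * 1/ suc k !

  -- Each further factor `1ℚ + x` moves the argument by `x` and raises the degree by one. At x = 1/n
  -- this compares (1 + 1/n)ⁿ with a partial sum of e.
  [1+x]^n≤expSum : ∀ {x} n → 0ℚ ≤ x → (1ℚ + x) ^ n ≤ expSum n (n × x)
  [1+x]^n≤expSum     zero    0≤x = ≤-refl
  [1+x]^n≤expSum {x} (suc n) 0≤x = begin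
    (1ℚ + x) * (1ℚ + x) ^ n           ≤⟨ *-monoˡ (0≤+ (0≤+n/d 1 1) 0≤x) ([1+x]^n≤expSum n 0≤x) ⟩
    (1ℚ + x) * expSum n y
      ≡⟨ solve 2 (λ x T → (con 1ℚ :+ x) :* T := T :+ x :* T) refl x (expSum n y) ⟩
    -- Only the first summand gains its term of degree n + 1, which gives the mixed degrees of
    -- `expSum-shift`.
    expSum n y + x * expSum n y       ≤⟨ +-monoˡ-≤ (x * expSum n y)
                                           (p≤p+q (expSum n y) (0≤* (0≤^ (suc n) 0≤y) (0≤1/! (suc n)))) ⟩
    expSum (suc n) y + x * expSum n y ≤⟨ expSum-shift n 0≤x 0≤y ⟩
    expSum (suc n) (y + x)            ≡⟨ cong (expSum (suc n)) (+-comm y x) ⟩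
    expSum (suc n) (suc n × x)        ∎
    where
    open +-*-Solver
    y = n × x
    0≤y = 0≤× n 0≤x

  eSeq-mono : ∀ {m n} → m ℕ.≤′ n → eSeq m ≤ eSeq n
  eSeq-mono ℕ.≤′-refl             = ≤-refl
  eSeq-mono (ℕ.≤′-step {n} m≤n) = ≤-trans (eSeq-mono m≤n) (p≤p+q (eSeq n) (0≤1/! (suc n)))

  -- Comparison of powers of 1 - 1/(M+1) with 1/e.

  module _ (M : ℕ) .{{_ : ℕ.NonZero M}} where
    private
      a = ℤ.+ 1 / M
      0≤a = 0≤+n/d 1 M

    1/[1+M] : ℚ
    1/[1+M] = ℤ.+ 1 / suc M

    0≤1/[1+M] : 0ℚ ≤ 1/[1+M]
    0≤1/[1+M] = 0≤+n/d 1 (suc M)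

    -- This is M/(M+1) ≤ 1 multiplied by 1/M.
    1/[1+M]≤1/M : 1/[1+M] ≤ a
    1/[1+M]≤1/M = begin
      q                     ≡⟨ trans (cong (q *_) (n×1/n≡1 M)) (*-identityʳ q) ⟨
      q * (M × a)           ≡⟨ trans (×-comm-* M q a) (sym (×-assoc-* M q a)) ⟩
      M × q * a             ≤⟨ *-monoʳ 0≤a (p≤p+q (M × q) 0≤1/[1+M]) ⟩
      (M × q + q) * a       ≡⟨ cong (_* a) (trans (+-comm (M × q) q) (n×1/n≡1 (suc M))) ⟩
      1ℚ * a                ≡⟨ *-identityˡ a ⟩
      a                     ∎
      where q = 1/[1+M]

    1-1/[1+M] : 1ℚ - 1/[1+M] ≡ M × 1/[1+M]
    1-1/[1+M] = trans (cong (_- 1/[1+M]) (sym (n×1/n≡1 (suc M))))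
      (solve 2 (λ p q → p :+ q :+ :- p := q) refl 1/[1+M] (M × 1/[1+M]))
      where open +-*-Solver

    0≤1-1/[1+M] : 0ℚ ≤ 1ℚ - 1/[1+M]
    0≤1-1/[1+M] = subst (0ℚ ≤_) (sym 1-1/[1+M]) (0≤× M 0≤1/[1+M])

    1-1/[1+M]≤1 : 1ℚ - 1/[1+M] ≤ 1ℚ
    1-1/[1+M]≤1 = subst (1ℚ - 1/[1+M] ≤_)
      (solve 1 (λ p → con 1ℚ :+ :- p :+ p := con 1ℚ) refl 1/[1+M]) (p≤p+q (1ℚ - 1/[1+M]) 0≤1/[1+M])
      where open +-*-Solver

    [1-1/[1+M]]*[1+1/M] : (1ℚ - 1/[1+M]) * (1ℚ + a) ≡ 1ℚ
    [1-1/[1+M]]*[1+1/M] = begin-equality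
      (1ℚ - q) * (1ℚ + a)     ≡⟨ *-distribˡ-+ (1ℚ - q) 1ℚ a ⟩
      (1ℚ - q) * 1ℚ + (1ℚ - q) * a
        ≡⟨ cong₂ _+_ (*-identityʳ (1ℚ - q)) (cong (_* a) 1-1/[1+M]) ⟩
      (1ℚ - q) + (M × q) * a  ≡⟨ cong ((1ℚ - q) +_) (trans (×-assoc-* M q a) (sym (×-comm-* M q a))) ⟩
      (1ℚ - q) + q * (M × a)  ≡⟨ cong (λ z → (1ℚ - q) + q * z) (n×1/n≡1 M) ⟩
      (1ℚ - q) + q * 1ℚ       ≡⟨ solve 1 (λ q → (con 1ℚ :+ :- q) :+ q :* con 1ℚ := con 1ℚ) refl q ⟩
      1ℚ ∎
      where
      open +-*-Solver
      q = 1/[1+M]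

    -- A division-free form of 1/e ≤ (1 - 1/(M+1))ᴹ. It covers every k ≥ M because the real `e` is
    -- given by its partial sums.
    1≤[1-1/[1+M]]^M*eSeq : ∀ {k} → M ℕ.≤ k → 1ℚ ≤ (1ℚ - 1/[1+M]) ^ M * eSeq k
    1≤[1-1/[1+M]]^M*eSeq {k} M≤k = begin
      1ℚ                      ≡⟨ 1^n≡1 M ⟨
      1ℚ ^ M                  ≡⟨ cong (_^ M) [1-1/[1+M]]*[1+1/M] ⟨
      (w * (1ℚ + a)) ^ M      ≡⟨ ^-distrib-* w (1ℚ + a) M ⟩
      w ^ M * (1ℚ + a) ^ M    ≤⟨ *-monoˡ 0≤w^M ([1+x]^n≤expSum M 0≤a) ⟩
      w ^ M * expSum M (M × a) ≡⟨ cong (λ z → w ^ M * expSum M z) (n×1/n≡1 M) ⟩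
      w ^ M * expSum M 1ℚ     ≡⟨ cong (w ^ M *_) (expSum-1 M) ⟩
      w ^ M * eSeq M          ≤⟨ *-monoˡ 0≤w^M (eSeq-mono (ℕ.≤⇒≤′ M≤k)) ⟩
      w ^ M * eSeq k          ∎
      where
      w = 1ℚ - 1/[1+M]
      0≤w^M = 0≤^ M 0≤1-1/[1+M]

    -- `f` stands for the denominator `1ℚ ⊔ eSeq k` in the terms of `e⁻¹`.
    1/-≤[1-1/[1+M]]^[1+M] : ∀ {k} f .{{_ : Positive f}} .{{_ : NonZero f}} → eSeq k ≤ f → M ℕ.≤ k →
           ℚ.1/ f ≤ (1ℚ - 1/[1+M]) ^ suc M + 1/[1+M]
    1/-≤[1-1/[1+M]]^[1+M] {k} f E≤f M≤k = begin
      ℚ.1/ f              ≤⟨ *-cancelʳ-≤-pos f (begin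
        ℚ.1/ f * f          ≡⟨ *-inverseˡ f ⟩
        1ℚ                ≤⟨ 1≤[1-1/[1+M]]^M*eSeq M≤k ⟩
        w ^ M * eSeq k    ≤⟨ *-monoˡ (0≤^ M 0≤1-1/[1+M]) E≤f ⟩
        w ^ M * f         ∎) ⟩
      -- Raising the exponent from M to M + 1 loses exactly `q * w ^ M`, which is at most `q`.
      w ^ M             ≡⟨ solve 2 (λ q P → P := (con 1ℚ :+ :- q) :* P :+ q :* P) refl q (w ^ M) ⟩
      w ^ suc M + q * w ^ M
        ≤⟨ +-monoʳ-≤ (w ^ suc M) (*-monoˡ 0≤1/[1+M] (^-≤1 M 0≤1-1/[1+M] 1-1/[1+M]≤1)) ⟩
      w ^ suc M + q * 1ℚ      ≡⟨ cong (w ^ suc M +_) (*-identityʳ q) ⟩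
      w ^ suc M + q           ∎
      where
      open +-*-Solver
      q = 1/[1+M]
      w = 1ℚ - q

  -- Finite sums and products, and sums over subsets.

  sum-mono : ∀ {n} {f g : Fin n → ℚ} → (∀ i → f i ≤ g i) → sum f ≤ sum g
  sum-mono {zero}  f≤g = ≤-refl
  sum-mono {suc n} f≤g = +-mono-≤ (f≤g zero) (sum-mono (f≤g ∘ suc))

  sum-1/[1+M] : ∀ M → sum {suc M} (λ _ → ℤ.+ 1 / suc M) ≡ 1ℚ
  sum-1/[1+M] M = trans (sum-replicate (suc M) {ℤ.+ 1 / suc M}) (n×1/n≡1 (suc M))

  0≤product : ∀ {n} {f : Fin n → ℚ} → (∀ i → 0ℚ ≤ f i) → 0ℚ ≤ product f
  0≤product {zero}  0≤f = 0≤+n/d 1 1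
  0≤product {suc n} 0≤f = 0≤* (0≤f zero) (0≤product (0≤f ∘ suc))

  sum⊆ : ∀ {n} → (Subset n → ℚ) → ℚ
  sum⊆ {zero}  f = f []
  sum⊆ {suc n} f = sum⊆ (f ∘ (outside ∷_)) + sum⊆ (f ∘ (inside ∷_))

  sum⊆-cong : ∀ {n} {f g : Subset n → ℚ} → (∀ I → f I ≡ g I) → sum⊆ f ≡ sum⊆ g
  sum⊆-cong {zero}  f≡g = f≡g []
  sum⊆-cong {suc n} f≡g = cong₂ _+_ (sum⊆-cong (f≡g ∘ (outside ∷_))) (sum⊆-cong (f≡g ∘ (inside ∷_)))

  sum⊆-mono : ∀ {n} {f g : Subset n → ℚ} → (∀ I → f I ≤ g I) → sum⊆ f ≤ sum⊆ g
  sum⊆-mono {zero}  f≤g = f≤g []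
  sum⊆-mono {suc n} f≤g = +-mono-≤ (sum⊆-mono (f≤g ∘ (outside ∷_))) (sum⊆-mono (f≤g ∘ (inside ∷_)))

  sum⊆-*ˡ : ∀ {n} c (f : Subset n → ℚ) → sum⊆ (λ I → c * f I) ≡ c * sum⊆ f
  sum⊆-*ˡ {zero}  c f = refl
  sum⊆-*ˡ {suc n} c f = trans (cong₂ _+_ (sum⊆-*ˡ c (f ∘ (outside ∷_))) (sum⊆-*ˡ c (f ∘ (inside ∷_))))
    (sym (*-distribˡ-+ c (sum⊆ (f ∘ (outside ∷_))) (sum⊆ (f ∘ (inside ∷_)))))

  -- The revenue from serving all arrivals under budget 1, written with `/ 1` to match the terms of
  -- `fromℕ`. It is 1 if some query arrives and 0 otherwise.
  cappedCount : ∀ {n} → Subset n → ℚ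
  cappedCount I = sum (λ j → ℤ.+ (if lookup I j then 1 else 0) / 1) ⊓ 1ℚ

  -- The product Bernoulli distribution on subsets.

  module Bernoulli (q : ℚ) (0≤q : 0ℚ ≤ q) (0≤1-q : 0ℚ ≤ 1ℚ - q) where

    weight : Bool → ℚ
    weight b = if b then q else 1ℚ - q

    pr : ∀ {n} → Subset n → ℚ
    pr I = product (λ j → weight (lookup I j))

    0≤weight : ∀ b → 0ℚ ≤ weight b
    0≤weight true  = 0≤q
    0≤weight false = 0≤1-q

    0≤pr : ∀ {n} (I : Subset n) → 0ℚ ≤ pr I
    0≤pr I = 0≤product (λ j → 0≤weight (lookup I j))

    -- Averaging over a coordinate leaves a quantity that ignores it unchanged; the inductions below
    -- discard coordinates this way.
    weights-sum : ∀ p → (1ℚ - q) * p + q * p ≡ p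
    weights-sum = solve 2 (λ q p → (con 1ℚ :+ :- q) :* p :+ q :* p := p) refl q
      where open +-*-Solver

    -- Events are Boolean functions because `ℙ` sees a decision procedure only through `does`.
    mass : ∀ {n} → (Subset n → Bool) → ℚ
    mass E = sum⊆ (λ I → if E I then pr I else 0ℚ)

    mass-∷ : ∀ {n} x (E : Subset n → Bool) →
             sum⊆ (λ I → if E I then pr (x ∷ I) else 0ℚ) ≡ weight x * mass E
    mass-∷ x E = trans (sum⊆-cong (λ I → pull (E I) (pr I)))
      (sum⊆-*ˡ (weight x) (λ I → if E I then pr I else 0ℚ))
      where
      pull : ∀ b p → (if b then weight x * p else 0ℚ) ≡ weight x * (if b then p else 0ℚ)
      pull true  p = refl
      pull false p = sym (*-zeroʳ (weight x))

    sum⊆-pr : ∀ n → sum⊆ (pr {n}) ≡ 1ℚ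
    sum⊆-pr zero    = refl
    sum⊆-pr (suc n) = trans
      (cong₂ _+_ (sum⊆-*ˡ {n} (1ℚ - q) pr) (sum⊆-*ˡ {n} q pr))
      (trans (weights-sum (sum⊆ {n} pr)) (sum⊆-pr n))

    mass-const : ∀ n b → mass {n} (λ _ → b) ≡ (if b then 1ℚ else 0ℚ)
    mass-const n       true  = sum⊆-pr n
    mass-const zero    false = refl
    mass-const (suc n) false = trans
      (cong₂ _+_ (mass-const n false) (mass-const n false)) (+-identityˡ 0ℚ)

    -- Coordinates before `j` average out; at `j` the event splits into two constant ones. A general
    -- `E` serves both arrival and agreement events.
    mass-lookup : ∀ {n} (j : Fin n) (E : Bool → Bool) →
      mass (λ I → E (lookup I j)) ≡
      (1ℚ - q) * (if E outside then 1ℚ else 0ℚ) + q * (if E inside then 1ℚ else 0ℚ)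
    mass-lookup {suc n} zero E = cong₂ _+_
      (trans (mass-∷ {n} outside (λ _ → E outside)) (cong ((1ℚ - q) *_) (mass-const n (E outside))))
      (trans (mass-∷ {n} inside (λ _ → E inside)) (cong (q *_) (mass-const n (E inside))))
    mass-lookup {suc n} (suc j) E = trans
      (cong₂ _+_ (mass-∷ outside (λ I → E (lookup I j))) (mass-∷ inside (λ I → E (lookup I j))))
      (trans (weights-sum _) (mass-lookup j E))

    mass-arrives : ∀ {n} (j : Fin n) → mass (λ I → does (j ∈? I)) ≡ q
    mass-arrives j = trans
      (sum⊆-cong (λ I → cong (if_then pr I else 0ℚ) (does-∈? j I)))
      (trans (mass-lookup j (λ b → b))
        (solve 1 (λ q → (con 1ℚ :+ :- q) :* con 0ℚ :+ q :* con 1ℚ := q) refl q))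
      where
      open +-*-Solver
      does-∈? : ∀ {n} (j : Fin n) I → does (j ∈? I) ≡ lookup I j
      does-∈? zero    (true  ∷ I) = refl
      does-∈? zero    (false ∷ I) = refl
      does-∈? (suc j) (_     ∷ I) = does-∈? j I

    mass-agrees : ∀ {n} (j : Fin n) b → mass (λ I → does (lookup I j Bool.≟ b)) ≡ weight b
    mass-agrees j b = trans (mass-lookup j (λ x → does (x Bool.≟ b))) (pick b)
      where
      open +-*-Solver
      pick : ∀ b → (1ℚ - q) * (if does (outside Bool.≟ b) then 1ℚ else 0ℚ) +
                   q * (if does (inside Bool.≟ b) then 1ℚ else 0ℚ) ≡ weight b
      pick true  = solve 1 (λ q → (con 1ℚ :+ :- q) :* con 0ℚ :+ q :* con 1ℚ := q) refl q
      pick false = solve 1 (λ q → (con 1ℚ :+ :- q) :* con 1ℚ :+ q :* con 0ℚ := con 1ℚ :+ :- q) refl q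

    -- Condition on the first query: if it is absent the capped count is that of the rest, and if it
    -- arrives the cap gives at most 1. The recursion F(n+1) ≤ (1-q)F(n) + q with F(0) = 0 yields
    -- the bound.
    mean-cappedCount : ∀ n →
      sum⊆ (λ (I : Subset n) → pr I * cappedCount I) ≤ 1ℚ - (1ℚ - q) ^ n
    mean-cappedCount zero    = ≤-refl
    mean-cappedCount (suc n) = begin
      sum⊆ {n} (λ I → (1ℚ - q) * pr I * cappedCount (outside ∷ I)) +
      sum⊆ {n} (λ I → q * pr I * cappedCount (inside ∷ I))
        ≤⟨ +-mono-≤ (≤-reflexive (sum⊆-cong {n} without)) (sum⊆-mono {n} with-first) ⟩
      sum⊆ {n} (λ I → (1ℚ - q) * (pr I * cappedCount I)) + sum⊆ {n} (λ I → q * pr I)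
        ≡⟨ cong₂ _+_ (sum⊆-*ˡ {n} (1ℚ - q) (λ I → pr I * cappedCount I)) (sum⊆-*ˡ {n} q pr) ⟩
      (1ℚ - q) * sum⊆ {n} (λ I → pr I * cappedCount I) + q * sum⊆ {n} pr
        ≤⟨ +-mono-≤ (*-monoˡ 0≤1-q (mean-cappedCount n)) (≤-reflexive (cong (q *_) (sum⊆-pr n))) ⟩
      (1ℚ - q) * (1ℚ - (1ℚ - q) ^ n) + q * 1ℚ
        ≡⟨ solve 2 (λ q P → (con 1ℚ :+ :- q) :* (con 1ℚ :+ :- P) :+ q :* con 1ℚ :=
             con 1ℚ :+ :- ((con 1ℚ :+ :- q) :* P)) refl q ((1ℚ - q) ^ n) ⟩
      1ℚ - (1ℚ - q) ^ suc n ∎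
      where
      open +-*-Solver
      count : Subset n → ℚ
      count I = sum (λ j → ℤ.+ (if lookup I j then 1 else 0) / 1)
      without : ∀ I → (1ℚ - q) * pr I * cappedCount (outside ∷ I) ≡ (1ℚ - q) * (pr I * cappedCount I)
      without I = trans (cong (λ z → (1ℚ - q) * pr I * (z ⊓ 1ℚ)) (+-identityˡ (count I)))
        (*-assoc (1ℚ - q) (pr I) (cappedCount I))
      with-first : ∀ I → q * pr I * cappedCount (inside ∷ I) ≤ q * pr I
      with-first I = subst (q * pr I * cappedCount (inside ∷ I) ≤_) (*-identityʳ (q * pr I))
        (*-monoˡ (0≤pr (inside ∷ I)) (p⊓q≤q (1ℚ + count I) 1ℚ))

  +n/1-mono : ∀ {m n} → m ℕ.≤ n → ℤ.+ m / 1 ≤ ℤ.+ n / 1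
  +n/1-mono {m} {n} m≤n = subst (ℤ.+ m / 1 ≤_)
    (trans (sym (/-distrib-+ m (n ℕ.∸ m) 1)) (cong (λ k → ℤ.+ k / 1) (ℕ.m+[n∸m]≡n m≤n)))
    (p≤p+q (ℤ.+ m / 1) (0≤+n/d (n ℕ.∸ m) 1))

open import Defs
open import Data.Empty using (⊥-elim)
open import Data.Product using (Σ-syntax; ∃-syntax; _×_; _,_; proj₁; proj₂)
open import Function using (id; mk⇔)
open import Level using (0ℓ)
open import Relation.Unary using (Pred; Decidable)
open import Relation.Nullary.Decidable using (does-⇔)
module R = Rational

-- From termwise rational statements to statements about reals.

≈-termwise : ∀ x y → (∀ k → seq x k ≡ seq y k) → x ≈ y
≈-termwise x y eq ε 0<ε = 0 , λ k _ → ℚ.≤-trans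
  (ℚ.≤-reflexive (cong ℚ.∣_∣ (trans (cong (ℚ._- seq y k) (eq k)) (ℚ.+-inverseʳ (seq y k)))))
  (ℚ.<⇒≤ 0<ε)

≤-eventually : ∀ x y N → (∀ k → N ℕ.≤ k → seq x k ℚ.≤ seq y k) → x ≤ y
≤-eventually x y N h ε 0<ε = N , λ k N≤k → ℚ.≤-trans (h k N≤k)
  (R.p≤p+q (seq y k) (ℚ.<⇒≤ 0<ε))

≤-termwise : ∀ x y → (∀ k → seq x k ℚ.≤ seq y k) → x ≤ y
≤-termwise x y h = ≤-eventually x y 0 (λ k _ → h k)

-- Used to strip the trailing `0ℝ` that a sum over one advertiser leaves behind.
≤-respˡ-termwise : ∀ x y z → (∀ k → seq x k ≡ seq y k) → y ≤ z → x ≤ z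
≤-respˡ-termwise x y z eq y≤z ε 0<ε = proj₁ (y≤z ε 0<ε) , λ k N≤k →
  subst (ℚ._≤ seq z k ℚ.+ ε) (sym (eq k)) (proj₂ (y≤z ε 0<ε) k N≤k)

0<1ℝ : 0ℝ < 1ℝ
0<1ℝ = 1ℚ , ℚ.positive⁻¹ 1ℚ , 0 , λ _ _ → ℚ.≤-refl

seq-∑ : ∀ {n} (f : Fin n → ℝ) k → seq (∑ f) k ≡ R.sum (λ i → seq (f i) k)
seq-∑ {zero}  f k = refl
seq-∑ {suc n} f k = trans (seq-+ (f zero) (∑ (f ∘ suc)) k)
  (cong (seq (f zero) k ℚ.+_) (seq-∑ (f ∘ suc) k))

seq-∏ : ∀ {n} (f : Fin n → ℝ) k → seq (∏ f) k ≡ R.product (λ i → seq (f i) k)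
seq-∏ {zero}  f k = refl
seq-∏ {suc n} f k = trans (seq-* (f zero) (∏ (f ∘ suc)) k)
  (cong (seq (f zero) k ℚ.*_) (seq-∏ (f ∘ suc) k))

seq-∑⊆ : ∀ {n} (f : Subset n → ℝ) k → seq (∑⊆ f) k ≡ R.sum⊆ (λ I → seq (f I) k)
seq-∑⊆ {zero}  f k = refl
seq-∑⊆ {suc n} f k = trans (seq-+ (∑⊆ (f ∘ (outside ∷_))) (∑⊆ (f ∘ (inside ∷_))) k)
  (cong₂ ℚ._+_ (seq-∑⊆ (f ∘ (outside ∷_)) k) (seq-∑⊆ (f ∘ (inside ∷_)) k))

seq-*1 : ∀ x k → seq (x * 1ℝ) k ≡ seq x k
seq-*1 x k = trans (seq-* x 1ℝ k) (ℚ.*-identityʳ (seq x k))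

seq-+0 : ∀ x k → seq (x + 0ℝ) k ≡ seq x k
seq-+0 x k = trans (seq-+ x 0ℝ k) (ℚ.+-identityʳ (seq x k))

-- The instance with one advertiser and M + 1 queries.

module Instance (M : ℕ) .{{_ : ℕ.NonZero M}} where

  q : ℚ
  q = R.1/[1+M] M

  open R.Bernoulli q (R.0≤1/[1+M] M) (R.0≤1-1/[1+M] M)

  -- Each query has its own customer, so no exclusivity constraint arises and all arrivals have to
  -- be independent.
  singleBidder : AdCellData
  singleBidder = record
    { m = 1 ; n = suc M ; #customers = suc M ; #times = 1
    ; b = λ _ → 1ℝ ; u = λ _ _ → 1ℝ ; p = λ _ → fromℚ q
    ; customer = id ; time = λ _ → zero
    ; Pr = λ I → fromℚ (pr I) }

  open AdCellData singleBidder using (ℙ; agrees?; arrives?; Independent)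

  seq-ℙ : ∀ {E : Pred (Subset (suc M)) 0ℓ} (E? : Decidable E) k → seq (ℙ E?) k ≡ mass (λ I → does (E? I))
  seq-ℙ E? k = trans (seq-∑⊆ {suc M} (λ I → if does (E? I) then fromℚ (pr I) else 0ℝ) k)
    (R.sum⊆-cong {suc M} (λ I → Bool.if-float (λ x → seq x k) (does (E? I)) {fromℚ (pr I)} {0ℝ}))

  -- Customer `c` owns query `c` alone, so agreement with `s` is a condition on that one coordinate;
  -- equivalent decidable events have equal `does`.
  seq-ℙ-agrees : ∀ s c k → seq (ℙ (agrees? s c zero)) k ≡ weight (lookup s c)
  seq-ℙ-agrees s c k = trans (seq-ℙ (agrees? s c zero) k) (trans
    (R.sum⊆-cong {suc M} (λ I → cong (if_then pr I else 0ℚ)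
      (does-⇔ (mk⇔ (λ h → h c refl refl) (λ { eq _ refl _ → eq }))
        (agrees? s c zero I) (lookup I c Bool.≟ lookup s c))))
    (mass-agrees c (lookup s c)))

  -- `pr` is by definition the product of the one-coordinate weights; the product over the single
  -- time only adds a factor `1ℝ`.
  independence : Independent
  independence s = ≈-termwise (fromℚ (pr s)) (∏ factor) λ k → sym (trans (seq-∏ factor k)
    (R.product-cong λ c → trans (seq-*1 (ℙ (agrees? s c zero)) k) (seq-ℙ-agrees s c k)))
    where
    factor : Fin (suc M) → ℝ
    factor c = ∏ {1} λ t → ℙ (agrees? s c t)

  G : AdCell
  G = record
    { adCellData = singleBidder
    ; b-positive = λ _ → 0<1ℝ
    ; u-nonNegative = λ _ _ → ≤-termwise 0ℝ 1ℝ λ _ → R.0≤+n/d 1 1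
    ; Pr-nonNegative = λ I → ≤-termwise 0ℝ (fromℚ (pr I)) λ _ → 0≤pr I
    ; Pr-total = ≈-termwise (∑⊆ {suc M} (fromℚ ∘ pr)) 1ℝ λ k →
        trans (seq-∑⊆ {suc M} (fromℚ ∘ pr) k) (sum⊆-pr (suc M))
    ; arrival = λ j → ≈-termwise (ℙ (arrives? j)) (fromℚ q) λ k → trans (seq-ℙ (arrives? j) k) (mass-arrives j)
    ; exclusive = λ j k j≢k c≡ → ⊥-elim (j≢k c≡)
    ; independent = independence }

  open AdCell G using (Allocation; IsAllocation; IsOptimalOffline; IsOptimalValue;
                       IsFeasible; revenue; value; 𝔼)

  seq-revenue : ∀ X k → seq (revenue X) k ≡ R.sum (λ j → ℤ.+ X zero j ℚ./ 1) ℚ.⊓ 1ℚ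
  seq-revenue X k = trans (seq-+0 (S ⊓ 1ℝ) k) (trans (seq-⊓ S 1ℝ k)
    (cong (ℚ._⊓ 1ℚ) (trans (seq-∑ (λ j → fromℕ (X zero j) * 1ℝ) k)
      (R.sum-cong-≗ λ j → seq-*1 (fromℕ (X zero j)) k))))
    where S = ∑ λ j → fromℕ (X zero j) * 1ℝ

  allArrivals : Subset (suc M) → Allocation
  allArrivals I _ j = if lookup I j then 1 else 0

  -- With one advertiser, `arrived` bounds every entry of an allocation by the arrival indicator,
  -- and revenue is monotone in the entries.
  allArrivals-optimal : ∀ I → IsOptimalOffline I (allArrivals I)
  allArrivals-optimal I = record
    { isAllocation = record
      { integral = λ _ j → indicator≤1 (lookup I j)
      ; arrived  = λ j → ℕ.≤-reflexive (ℕ.+-identityʳ _) }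
    ; maximal = λ Y isAlloc → ≤-termwise (revenue Y) (revenue (allArrivals I)) λ k →
        subst₂ ℚ._≤_ (sym (seq-revenue Y k)) (sym (seq-revenue (allArrivals I) k))
          (ℚ.⊓-monoˡ-≤ 1ℚ (R.sum-mono λ j → R.+n/1-mono
            (subst (ℕ._≤ allArrivals I zero j) (ℕ.+-identityʳ (Y zero j))
              (IsAllocation.arrived isAlloc j)))) }
    where
    indicator≤1 : ∀ b → (if b then 1 else 0) ℕ.≤ 1
    indicator≤1 true  = ℕ.≤-refl
    indicator≤1 false = ℕ.z≤n

  uniformSpend : ℝ
  uniformSpend = ∑ {suc M} λ _ → fromℚ q * 1ℝ

  seq-uniformSpend : ∀ k → seq uniformSpend k ≡ 1ℚ
  seq-uniformSpend k = trans (seq-∑ {suc M} (λ _ → fromℚ q * 1ℝ) k)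
    (trans (R.sum-cong-≗ {suc M} λ _ → seq-*1 (fromℚ q) k) (R.sum-1/[1+M] M))

  -- The constant solution `q` meets all supplies and the budget with equality. Conversely, since
  -- bids are 1, the budget constraint itself bounds the value by 1.
  optimalValue : IsOptimalValue 1ℝ
  optimalValue =
    ( (λ _ _ → fromℚ q) , feasible
    , ≈-termwise (value λ _ _ → fromℚ q) 1ℝ λ k → trans (seq-+0 uniformSpend k) (seq-uniformSpend k)) ,
    λ x isFeasible → ≤-respˡ-termwise (value x) (spend x) 1ℝ (seq-+0 (spend x))
      (IsFeasible.budget isFeasible zero)
    where
    spend : (Fin 1 → Fin (suc M) → ℝ) → ℝ
    spend x = ∑ λ j → x zero j * 1ℝ
    q≤1 : q ℚ.≤ 1ℚ
    q≤1 = ℚ.≤-trans (R.p≤p+q q (R.0≤× M (R.0≤1/[1+M] M))) (ℚ.≤-reflexive (R.n×1/n≡1 (suc M)))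
    feasible : IsFeasible (λ _ _ → fromℚ q)
    feasible = record
      { supply = λ _ → ≤-termwise (fromℚ q + 0ℝ) (fromℚ q) λ k → ℚ.≤-reflexive (seq-+0 (fromℚ q) k)
      ; budget = λ _ → ≤-termwise uniformSpend 1ℝ λ k → ℚ.≤-reflexive (seq-uniformSpend k)
      ; bounds = λ _ _ → ≤-termwise 0ℝ (fromℚ q) (λ _ → R.0≤1/[1+M] M)
                       , ≤-termwise (fromℚ q) 1ℝ λ _ → q≤1 }

  seq-𝔼-revenue : ∀ k → seq (𝔼 (revenue ∘ allArrivals)) k ℚ.≤ 1ℚ ℚ.- (1ℚ ℚ.- q) R.^ suc M
  seq-𝔼-revenue k = ℚ.≤-trans
    (ℚ.≤-reflexive (trans (seq-∑⊆ {suc M} (λ I → fromℚ (pr I) * revenue (allArrivals I)) k)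
      (R.sum⊆-cong {suc M} λ I → trans (seq-* (fromℚ (pr I)) (revenue (allArrivals I)) k)
        (cong (pr I ℚ.*_) (seq-revenue (allArrivals I) k)))))
    (mean-cappedCount (suc M))

  -- The proof `0<e` supplies the lower bound 1, so `inv` takes the reciprocal of `1ℚ ⊔ eSeq k`.
  seq-e⁻¹ : ∀ k → M ℕ.≤ k → seq e⁻¹ k ℚ.≤ (1ℚ ℚ.- q) R.^ suc M ℚ.+ q
  seq-e⁻¹ k M≤k = R.1/-≤[1-1/[1+M]]^[1+M] M f {{f-positive}} {{ℚ.pos⇒nonZero f {{f-positive}}}}
    (ℚ.p≤q⊔p 1ℚ (eSeq k)) M≤k
    where
    f = 1ℚ ℚ.⊔ eSeq k
    f-positive = ℚ.positive (ℚ.<-≤-trans (ℚ.positive⁻¹ 1ℚ) (ℚ.p≤p⊔q 1ℚ (eSeq k)))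

mainTheorem5 : ∀ (δ : ℝ) → 0ℝ < δ →
    Σ[ G ∈ AdCell ] let open AdCell G in
    (∀ i j → u i j ≤ b i) ×
    (Σ[ X ∈ (Subset n → Allocation) ] Σ[ OPT ∈ ℝ ]
    (∀ I → IsOptimalOffline I (X I)) ×
    IsOptimalValue OPT ×
    0ℝ < OPT ×
    𝔼 (λ I → revenue (X I)) ≤ (1ℝ - e⁻¹ + δ) * OPT)
mainTheorem5 δ (ε , 0<ε , N , ε≤δ) =
  G , (λ _ _ → ≤-termwise 1ℝ 1ℝ λ _ → ℚ.≤-refl) ,
  allArrivals , 1ℝ , allArrivals-optimal , optimalValue , 0<1ℝ ,
  ≤-eventually (AdCell.𝔼 G (AdCell.revenue G ∘ allArrivals))
    -- From index `M` the bound on `e⁻¹` holds, and from `N` the terms of `δ` are at least `ε`.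
    ((1ℝ - e⁻¹ + δ) * 1ℝ) (M ℕ.⊔ N) bound
  where
  -- With this choice 1/(M+1) ≤ 1/M ≤ ε.
  M = ℚ.↧ₙ ε
  open Instance M
  W = (1ℚ ℚ.- q) R.^ suc M

  q≤ε : q ℚ.≤ ε
  q≤ε = ℚ.≤-trans (R.1/[1+M]≤1/M M) (R.1/↧≤ ε 0<ε)

  bound : ∀ k → M ℕ.⊔ N ℕ.≤ k →
          seq (AdCell.𝔼 G (AdCell.revenue G ∘ allArrivals)) k ℚ.≤ seq ((1ℝ - e⁻¹ + δ) * 1ℝ) k
  bound k h = begin
    seq (AdCell.𝔼 G (AdCell.revenue G ∘ allArrivals)) k  ≤⟨ seq-𝔼-revenue k ⟩
    1ℚ ℚ.- W
      -- `W + q` dominates the term of `e⁻¹`, and the compensating `q` is absorbed by `δ`.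
      ≡⟨ solve 2 (λ W q → con 1ℚ :+ :- W := con 1ℚ :+ :- (W :+ q) :+ q) refl W q ⟩
    1ℚ ℚ.- (W ℚ.+ q) ℚ.+ q
      ≤⟨ ℚ.+-mono-≤ (ℚ.+-monoʳ-≤ 1ℚ (ℚ.neg-antimono-≤ (seq-e⁻¹ k (ℕ.≤-trans (ℕ.m≤m⊔n M N) h)))) q≤δₖ ⟩
    1ℚ ℚ.- seq e⁻¹ k ℚ.+ seq δ k             ≡⟨ cong (ℚ._+ seq δ k) (seq-+ 1ℝ (- e⁻¹) k) ⟨
    seq (1ℝ - e⁻¹) k ℚ.+ seq δ k             ≡⟨ seq-+ (1ℝ - e⁻¹) δ k ⟨
    seq (1ℝ - e⁻¹ + δ) k                     ≡⟨ seq-*1 (1ℝ - e⁻¹ + δ) k ⟨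
    seq ((1ℝ - e⁻¹ + δ) * 1ℝ) k              ∎
    where
    open ℚ.≤-Reasoning
    open +-*-Solver
    q≤δₖ : q ℚ.≤ seq δ k
    q≤δₖ = ℚ.≤-trans q≤ε (ℚ.≤-trans (ℚ.≤-reflexive (sym (ℚ.+-identityˡ ε)))
      (ε≤δ k (ℕ.≤-trans (ℕ.m≤n⊔m M N) h)))
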